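{- There is an absolute constant $C>0$ such that the following holds. Let $d\ge 1$, let $B_0,B_1,\ldots,B_d\in\mathbb{Z}^d$, let $S=\mathrm{Conv}(B_0,B_1,\ldots,B_d)$ and let $B=\{B_0,B_1,\ldots,B_d\}$. Then for every vector $b\in \mathrm{int.cone}(S\cap\mathbb{Z}^d)$ there exists an integral vector $\lambda\in\mathbb{Z}_{\ge 0}^{S\cap\mathbb{Z}^d}$ with $b=\sum_{s\in S\cap\mathbb{Z}^d}\lambda_s s$ such that (1) $\lambda_s\le 2^{2^{Cd}}$ for all $s\in (S\cap\mathbb{Z}^d)\setminus B$, and (2) $|\mathrm{supp}(\lambda)\setminus B|\le 2^d$.
   Context: For a polytope $\mathcal{P}\subset\mathbb{R}^d$, $\mathrm{int.cone}(\mathcal{P}\cap\mathbb{Z}^d)=\{\sum_{p\in\mathcal{P}\cap\mathbb{Z}^d}\lambda_p p \mid \lambda\in\mathbb{Z}_{\ge0}^{\mathcal{P}\cap\mathbb{Z}^d}\}$. $\mathrm{Conv}(X)$ denotes the convex hull of $X$. For a vector $\lambda$ indexed by a set $M$, $\mathrm{supp}(\lambda)=\{s\in M\mid \lambda_s\neq 0\}$. -}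

module Defs where

open import Data.Nat as ℕ using (ℕ; zero; suc)
open import Data.Integer as ℤ using (ℤ; +_)
open import Data.Rational as ℚ using (ℚ; 0ℚ; 1ℚ)
open import Data.Fin using (Fin; zero; suc)
open import Data.Fin.Properties using (any?)
open import Data.Vec using (Vec; lookup; zipWith; replicate; map)
open import Data.Vec.Properties using (≡-dec)
open import Data.List as List using (List; []; _∷_; filter; length)
open import Data.List.Relation.Unary.All using (All)
open import Data.List.Relation.Unary.Unique.Propositional using (Unique)
open import Data.Product using (Σ; ∃; _×_; _,_; proj₁; proj₂)
open import Relation.Binary.PropositionalEquality using (_≡_)
open import Relation.Nullary using (Dec; ¬_; ¬?)
open import Relation.Nullary.Decidable using (_×-dec_)

Point : ℕ → Set
Point d = Vec ℤ d

toℚ : ℤ → ℚ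
toℚ z = z ℚ./ 1

sumℚ : {n : ℕ} → (Fin n → ℚ) → ℚ
sumℚ {zero}  f = 0ℚ
sumℚ {suc n} f = f zero ℚ.+ sumℚ (λ i → f (suc i))

-- p ∈ Conv(B_0,…,B_d): p is a convex combination (rational, hence real,
-- coefficients) of the B_i.
InConv : {d : ℕ} → (Fin (suc d) → Point d) → Point d → Set
InConv {d} B p =
  Σ (Fin (suc d) → ℚ) λ μ →
    ((i : Fin (suc d)) → 0ℚ ℚ.≤ μ i) ×
    (sumℚ μ ≡ 1ℚ) ×
    ((j : Fin d) → toℚ (lookup p j) ≡ sumℚ (λ i → μ i ℚ.* toℚ (lookup (B i) j)))

InB : {d : ℕ} → (Fin (suc d) → Point d) → Point d → Set
InB B p = ∃ λ i → B i ≡ p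

inB? : {d : ℕ} (B : Fin (suc d) → Point d) (p : Point d) → Dec (InB B p)
inB? B p = any? (λ i → ≡-dec ℤ._≟_ (B i) p)

-- A finitely supported coefficient vector λ, listed as (point, coefficient)
-- pairs; the value Σ λ_s s.
combo : {d : ℕ} → List (Point d × ℕ) → Point d
combo []             = replicate _ (+ 0)
combo ((p , k) ∷ L) = zipWith ℤ._+_ (map (+ k ℤ.*_) p) (combo L)

InIntCone : {d : ℕ} → (Fin (suc d) → Point d) → Point d → Set
InIntCone B b =
  ∃ λ (L : List (Point _ × ℕ)) →
    All (λ e → InConv B (proj₁ e)) L × combo L ≡ b

suppOutsideB : {d : ℕ} → (Fin (suc d) → Point d) → List (Point d × ℕ) → List (Point d × ℕ)
suppOutsideB B = filter (λ e → ¬? (proj₂ e ℕ.≟ 0) ×-dec ¬? (inB? B (proj₁ e)))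

{-# OPTIONS --safe #-}

-- Starting from any representation of b, apply two replacements as long as possible.
-- (a) A lattice point s = Σ μᵢ Bᵢ outside B of large multiplicity: if m ≥ 2 satisfies Σ ⌊m μᵢ⌋ ≥ m − 1,
--     then m copies of s can be traded for m − 1 vertices and one further lattice point of S, which lowers
--     the total multiplicity outside B. Such an m of size 2^2^O(d) exists: approximate simultaneously, by
--     Dirichlet's theorem, the large μᵢ with a precision proportional to μᵢ. If the resulting bound on m
--     is not small against 1/μⱼ for some remaining μⱼ, count μⱼ as large too; this squares the bound (up
--     to a factor d + 2), and it happens at most d + 1 times.
-- (b) Two distinct points p, q outside B that are congruent mod 2: trade p + q for 2 ((p + q) / 2). This
--     does not raise the multiplicity outside B, and lowers Σ λₛ |s|² (Eisenbrand and Shmonin).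
-- When neither applies, multiplicities outside B are bounded by (a), and by (b) the support outside B has
-- at most one point in each of the 2^d residue classes mod 2.
module Submission where

open import Defs
open import Algebra.Properties.AbelianGroup using (∙-cancelʳ)
import Algebra.Properties.Semiring.Sum as Sum
open import Data.Fin as Fin using (Fin; zero; suc; toℕ; combine; fromℕ<)
open import Data.Fin.Properties using (combine-injective; pigeonhole; toℕ-fromℕ<; toℕ<n)
open import Data.Integer as ℤ using (ℤ; +_; -[1+_]; ∣_∣)
open import Data.Integer.DivMod as ℤ using (_/ℕ_; _%ℕ_)
import Data.Integer.Properties as ℤ
open import Data.Integer.Tactic.RingSolver using () renaming (solve-∀ to ℤ-solve-∀)
open import Data.List as List using (List; []; _∷_; _++_; map; length; allFin)
open import Data.List.Membership.Propositional using (_∈_; find)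
open import Data.List.Membership.Propositional.Properties using (∈-allFin; ∈-filter⁻; ∈-lookup; ∈-∃++)
open import Data.List.Properties using (length-tabulate)
open import Data.List.Relation.Binary.Permutation.Propositional as Perm using (_↭_; ↭-reflexive; ↭-trans; ↭⇒↭ₛ)
open import Data.List.Relation.Binary.Permutation.Propositional.Properties using (All-resp-↭; ∈-resp-↭; map⁺; shift; ↭-length)
import Data.List.Relation.Binary.Permutation.Setoid.Properties as Permₛ
open import Data.List.Relation.Unary.All as All using (All; []; _∷_)
import Data.List.Relation.Unary.All.Properties as All
open import Data.List.Relation.Unary.AllPairs using (AllPairs; []; _∷_)
import Data.List.Relation.Unary.AllPairs.Properties as AllPairs
open import Data.List.Relation.Unary.Any as Any using (here; there)
open import Data.List.Relation.Unary.Unique.Propositional using (Unique)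
open import Data.Nat as ℕ using (ℕ; zero; suc; _≤_; _<_; _*_; _^_; _+_; _∸_; _/_; _%_; s≤s; z≤n; NonZero; >-nonZero; _<?_)
open import Data.Nat.DivMod using (_mod_; m%n<n; m≡m%n+[m/n]*n; /-monoˡ-≤)
open import Data.Nat.ListAction using (product)
open import Data.Nat.Properties as ℕ hiding (_≟_; _<?_; _≤?_)
open import Data.Nat.Tactic.RingSolver using () renaming (solve-∀ to ℕ-solve-∀)
open import Data.Product using (Σ; ∃; ∃₂; _×_; _,_; proj₁; proj₂)
open import Data.Rational as ℚ using (ℚ; 0ℚ; 1ℚ; mkℚ; *≤*; toℚᵘ)
import Data.Rational.Properties as ℚ
open import Data.Rational.Unnormalised as ℚᵘ using (mkℚᵘ; *≡*)
import Data.Rational.Unnormalised.Properties as ℚᵘ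
open import Data.Sum using (_⊎_; inj₁; inj₂)
open import Data.Vec as Vec using (Vec; lookup; tabulate; []; _∷_)
import Data.Vec.Properties as Vec
open import Function using (_∘_)
open import Relation.Binary.PropositionalEquality
open import Relation.Nullary using (yes; no; ¬_; ¬?; contradiction)
open import Relation.Nullary.Decidable using (_×-dec_)

module ℕΣ = Sum ℕ.+-*-semiring
module ℤΣ = Sum ℤ.+-*-semiring

-- Simultaneous Dirichlet approximation with a separate precision for each weight.

extract : ∀ {A : Set} {x : A} {xs} → x ∈ xs → ∃ λ ys → xs ↭ x ∷ ys
extract {x = x} x∈xs with ys , zs , eq ← ∈-∃++ x∈xs = _ , ↭-trans (↭-reflexive eq) (shift x ys zs)

-- |x / N − n| ≤ 1 / q, without subtraction or division.
Close : ℕ → ℕ → ℕ → ℕ → Set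
Close N q x n = q * x ≤ q * (n * N) + N × q * (n * N) ≤ q * x + N

-- For `x ≤ y` no error term is needed. Otherwise `x = y + δ`, the hypothesis becomes `q * δ ≤ N`,
-- and replacing `q` by the smaller `c` keeps it true.
≤-scale : ∀ {c q x y N} → c ≤ q → q * x ≤ q * y + N → c * x ≤ c * y + N
≤-scale {c} {q} {x} {y} {N} c≤q h with ≤-total x y
... | inj₁ x≤y = ≤-trans (*-monoʳ-≤ c x≤y) (m≤m+n _ N)
... | inj₂ y≤x with δ , refl ← m≤n⇒∃[o]m+o≡n y≤x = begin
  c * (y + δ)    ≡⟨ *-distribˡ-+ c y δ ⟩
  c * y + c * δ  ≤⟨ +-monoʳ-≤ (c * y) (≤-trans (*-monoˡ-≤ δ c≤q) qδ≤N) ⟩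
  c * y + N      ∎
  where
  open ≤-Reasoning
  qδ≤N : q * δ ≤ N
  qδ≤N = +-cancelˡ-≤ (q * y) _ _ (subst (_≤ q * y + N) (*-distribˡ-+ q y δ) h)

close-antimono : ∀ {N c q x n} → c ≤ q → Close N q x n → Close N c x n
close-antimono c≤q (h₁ , h₂) = ≤-scale c≤q h₁ , ≤-scale c≤q h₂

module _ (N : ℕ) .{{_ : NonZero N}} where

  -- The circle ℝ/ℤ is cut into `q` equal arcs, and this is the index of the arc containing
  -- `k * a / N` modulo 1.
  cell : (a q k : ℕ) → .{{NonZero q}} → Fin q
  cell a q k = (q * (k * a) / N) mod q

  cells : (ps : List (ℕ × ℕ)) → All (NonZero ∘ proj₂) ps → ℕ → Fin (product (map proj₂ ps))
  cells []             _          k = zero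
  cells ((a , q) ∷ ps) (q≢0 ∷ nz) k = combine (cell a q k {{q≢0}}) (cells ps nz k)

  -- Equal cells make the quotients `t₁` and `t₂` differ by a multiple `n * q`. The remainders `s₁`
  -- and `s₂` are below `N`, so `q * (δ * a)` and `q * (n * N)` differ by less than `N`.
  cell-close : ∀ a q k δ .{{_ : NonZero q}} → cell a q k ≡ cell a q (k + δ) → ∃ (Close N q (δ * a))
  cell-close a q k δ eq = n , upper , lower
    where
    open ≡-Reasoning
    t₁ = q * (k * a) / N
    t₂ = q * ((k + δ) * a) / N
    s₁ = q * (k * a) % N
    s₂ = q * ((k + δ) * a) % N
    r≡ : t₁ % q ≡ t₂ % q
    r≡ = trans (sym (toℕ-fromℕ< (m%n<n t₁ q))) (trans (cong toℕ eq) (toℕ-fromℕ< (m%n<n t₂ q)))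
    t₁≤t₂ : t₁ ≤ t₂
    t₁≤t₂ = /-monoˡ-≤ N (*-monoʳ-≤ q (*-monoˡ-≤ a (m≤m+n k δ)))
    n = proj₁ (m≤n⇒∃[o]m+o≡n (/-monoˡ-≤ q t₁≤t₂))
    d₂≡ : t₁ / q + n ≡ t₂ / q
    d₂≡ = proj₂ (m≤n⇒∃[o]m+o≡n (/-monoˡ-≤ q t₁≤t₂))
    t₂≡ : t₂ ≡ t₁ + n * q
    t₂≡ = begin
      t₂                                ≡⟨ m≡m%n+[m/n]*n t₂ q ⟩
      t₂ % q + t₂ / q * q               ≡⟨ cong₂ (λ r d → r + d * q) (sym r≡) (sym d₂≡) ⟩
      t₁ % q + (t₁ / q + n) * q         ≡⟨ lem₀ (t₁ % q) (t₁ / q) n q ⟩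
      (t₁ % q + t₁ / q * q) + n * q     ≡⟨ cong (_+ n * q) (m≡m%n+[m/n]*n t₁ q) ⟨
      t₁ + n * q                        ∎
      where
      lem₀ : ∀ r d n q → r + (d + n) * q ≡ (r + d * q) + n * q
      lem₀ = ℕ-solve-∀
    balance : s₁ + q * (δ * a) ≡ s₂ + q * (n * N)
    balance = +-cancelʳ-≡ (t₁ * N) _ _ (begin
      s₁ + q * (δ * a) + t₁ * N    ≡⟨ lem₁ s₁ (q * (δ * a)) (t₁ * N) ⟩
      (s₁ + t₁ * N) + q * (δ * a)  ≡⟨ cong (_+ q * (δ * a)) (m≡m%n+[m/n]*n (q * (k * a)) N) ⟨
      q * (k * a) + q * (δ * a)    ≡⟨ lem₂ q k a δ ⟩
      q * ((k + δ) * a)            ≡⟨ m≡m%n+[m/n]*n (q * ((k + δ) * a)) N ⟩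
      s₂ + t₂ * N                  ≡⟨ cong (λ t → s₂ + t * N) t₂≡ ⟩
      s₂ + (t₁ + n * q) * N        ≡⟨ lem₃ s₂ t₁ n q N ⟩
      s₂ + q * (n * N) + t₁ * N    ∎)
      where
      lem₁ : ∀ x y z → x + y + z ≡ (x + z) + y
      lem₁ = ℕ-solve-∀
      lem₂ : ∀ q k a δ → q * (k * a) + q * (δ * a) ≡ q * ((k + δ) * a)
      lem₂ = ℕ-solve-∀
      lem₃ : ∀ s t n q N → s + (t + n * q) * N ≡ s + q * (n * N) + t * N
      lem₃ = ℕ-solve-∀
    upper : q * (δ * a) ≤ q * (n * N) + N
    upper = ≤-trans (m≤n+m _ s₁) (≤-trans (≤-reflexive (trans balance (+-comm s₂ _)))
              (+-monoʳ-≤ _ (<⇒≤ (m%n<n (q * ((k + δ) * a)) N))))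
    lower : q * (n * N) ≤ q * (δ * a) + N
    lower = ≤-trans (m≤n+m _ s₂) (≤-trans (≤-reflexive (trans (sym balance) (+-comm s₁ _)))
              (+-monoʳ-≤ _ (<⇒≤ (m%n<n (q * (k * a)) N))))

  cells-close : ∀ ps nz k δ → cells ps nz k ≡ cells ps nz (k + δ) →
    All (λ e → ∃ (Close N (proj₂ e) (δ * proj₁ e))) ps
  cells-close []             _          k δ _  = []
  cells-close ((a , q) ∷ ps) (q≢0 ∷ nz) k δ eq =
    let eq₁ , eq₂ = combine-injective (cell a q k {{q≢0}}) (cells ps nz k) _ _ eq
    in cell-close a q k δ {{q≢0}} eq₁ ∷ cells-close ps nz k δ eq₂

  -- One more multiplier than there are tuples of cells, starting from 0: two of them collide, and
  -- their difference is the required `k`.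
  dirichlet : ∀ ps → All (NonZero ∘ proj₂) ps →
    ∃ λ k → 1 ≤ k × k ≤ product (map proj₂ ps) ×
            All (λ e → ∃ (Close N (proj₂ e) (k * proj₁ e))) ps
  dirichlet ps nz
    with i , j , i<j , eq ← pigeonhole (n<1+n (product (map proj₂ ps))) (cells ps nz ∘ toℕ)
    = δ , m<n⇒0<n∸m i<j , ≤-trans (m∸n≤m (toℕ j) (toℕ i)) (≤-pred (toℕ<n j)) ,
      cells-close ps nz (toℕ i) δ (trans eq (cong (cells ps nz) (sym (m+[n∸m]≡n (<⇒≤ i<j)))))
    where δ = toℕ j ∸ toℕ i

  -- Approximation with errors bounded by the weights themselves.

  module _ {n : ℕ} (c : ℕ) (1≤c : 1 ≤ c) (a : Fin n → ℕ) where

    instance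
      c≢0 : NonZero c
      c≢0 = >-nonZero 1≤c

    -- The second clause says that the weight `a / N` is at least `1 / q`, so an error of `1 / q`
    -- never exceeds the weight.
    Scales : List (ℕ × ℕ) → Set
    Scales = All (λ e → c ≤ proj₂ e × N ≤ proj₂ e * proj₁ e)

    -- The last clause puts `m` below `k + 1` times the weight. It later keeps the barycentric
    -- coordinates of the leftover point nonnegative.
    Approx : ℕ → Fin n → Set
    Approx k i = ∃ λ m → Close N c (k * a i) m × m * N ≤ suc k * a i

    scales-nonZero : ∀ {ps} → Scales ps → All (NonZero ∘ proj₂) ps
    scales-nonZero = All.map (λ h → >-nonZero (≤-trans 1≤c (proj₁ h)))

    1≤product : ∀ {ps} → Scales ps → 1 ≤ product (map proj₂ ps)
    1≤product []               = ≤-refl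
    1≤product ((c≤q , _) ∷ ss) = *-mono-≤ (≤-trans 1≤c c≤q) (1≤product ss)

    -- `m` exceeds `k * x / N` by at most `1 / q`, and one further copy of the weight `x / N` pays
    -- for that.
    close⇒floor : ∀ {q x k m} → c ≤ q → N ≤ q * x → Close N q (k * x) m → m * N ≤ suc k * x
    close⇒floor {q} {x} {k} {m} c≤q N≤qx (_ , h) =
      *-cancelˡ-≤ q {{>-nonZero (≤-trans 1≤c c≤q)}} (begin
        q * (m * N)          ≤⟨ h ⟩
        q * (k * x) + N      ≤⟨ +-monoʳ-≤ _ N≤qx ⟩
        q * (k * x) + q * x  ≡⟨ lem q k x ⟩
        q * (suc k * x)      ∎)
      where
      open ≤-Reasoning
      lem : ∀ q k x → q * (k * x) + q * x ≡ q * (suc k * x)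
      lem = ℕ-solve-∀

    -- ps pairs the weights already approximated with precision 1/q where q is their scale, and us lists
    -- the remaining indices. If some remaining a i / N is at least 1/(c * M), where M is the
    -- product of the scales, it gets the scale c * M, so that M becomes c * M²; otherwise all remaining
    -- weights stay below 1/c after multiplication with the k ≤ M supplied by Dirichlet's theorem.
    approx-step : ∀ t us ps → length us ≡ t → Scales ps →
      (∀ i → i ∈ us ⊎ ∃ λ q → (a i , q) ∈ ps) →
      ∃ λ k → 1 ≤ k × k ≤ (c * product (map proj₂ ps)) ^ (2 ^ t) × (∀ i → Approx k i)
    approx-step t us ps len ss cover with Any.any? (λ i → N <? c * (product (map proj₂ ps) * a i)) us
    ... | no none
      with k , 1≤k , k≤M , closes ← dirichlet ps (scales-nonZero ss)
      = k , 1≤k , ≤-trans k≤M M≤ , approx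
      where
      M = product (map proj₂ ps)
      M≤ : M ≤ (c * M) ^ (2 ^ t)
      M≤ = ≤-trans (m≤n*m M c) (m≤m^n (c * M) (m^n>0 2 t))
        where
        m≤m^n : ∀ x {e} → 1 ≤ e → x ≤ x ^ e
        m≤m^n x {suc zero}    _ = ≤-reflexive (sym (*-identityʳ x))
        m≤m^n zero {suc (suc e)}    _ = z≤n
        m≤m^n x@(suc _) {suc (suc e)} _ = m≤m*n x (x ^ suc e) {{m^n≢0 x (suc e)}}
      approx : ∀ i → Approx k i
      approx i with cover i
      ... | inj₂ (q , e∈ps) =
        let c≤q , N≤qa = All.lookup ss e∈ps
            m , close  = All.lookup closes e∈ps
        in m , close-antimono {n = m} c≤q close , close⇒floor {q} {a i} {k} {m} c≤q N≤qa close
      -- The weight is at most `1 / (c * M)` and `k ≤ M`, so `k` times the weight is within `1 / c`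
      -- of 0.
      ... | inj₁ i∈us = 0 , (≤-trans (*-monoʳ-≤ c (*-monoˡ-≤ (a i) k≤M)) small , lower) , z≤n
        where
        small : c * (M * a i) ≤ c * 0 + N
        small = subst (λ z → c * (M * a i) ≤ z + N) (sym (*-zeroʳ c)) (≮⇒≥ (All.lookup (All.¬Any⇒All¬ us none) i∈us))
        lower : c * 0 ≤ c * (k * a i) + N
        lower = ≤-trans (≤-reflexive (*-zeroʳ c)) z≤n
    ... | yes some with i , i∈us , N<cMa ← find some with us′ , us↭ ← extract i∈us with t
    ...   | zero with () ← trans (sym len) (↭-length us↭)
    ...   | suc t′ =
      let k , 1≤k , k≤ , approx = approx-step t′ us′ ((a i , c * M) ∷ ps)
            (suc-injective (trans (sym (↭-length us↭)) len))
            ((m≤m*n c M {{>-nonZero (1≤product ss)}} , ≤-trans (<⇒≤ N<cMa) (≤-reflexive (sym (*-assoc c M (a i))))) ∷ ss)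
            cover′
      in k , 1≤k , ≤-trans k≤ (≤-reflexive bound) , approx
      where
      M = product (map proj₂ ps)
      cover′ : ∀ j → j ∈ us′ ⊎ ∃ λ q → (a j , q) ∈ (a i , c * M) ∷ ps
      cover′ j with cover j
      ... | inj₂ (q , e∈ps) = inj₂ (q , there e∈ps)
      ... | inj₁ j∈us with ∈-resp-↭ us↭ j∈us
      ...   | here refl   = inj₂ (c * M , here refl)
      ...   | there j∈us′ = inj₁ j∈us′
      lem : ∀ c M → c * (c * M * M) ≡ c * M * (c * M * 1)
      lem = ℕ-solve-∀
      -- The new product of scales is `c * M * M`, and `c` times it is the square of `c * M`. One
      -- index fewer remains, so the halved exponent absorbs the squaring.
      bound : (c * (c * M * M)) ^ (2 ^ t′) ≡ (c * M) ^ (2 ^ suc t′)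
      bound = trans (cong (_^ (2 ^ t′)) (lem c M)) (^-*-assoc (c * M) 2 (2 ^ t′))

    simultaneous-approx : ∃ λ k → 1 ≤ k × k ≤ c ^ (2 ^ n) × (∀ i → Approx k i)
    simultaneous-approx =
      -- Initially no weight has a scale; the empty product is 1, so the bound starts from `c * 1`.
      let k , 1≤k , k≤ , approx = approx-step n (allFin n) [] (length-tabulate {n = n} (λ i → i)) [] (λ i → inj₁ (∈-allFin i))
      in k , 1≤k , subst (λ x → k ≤ x ^ (2 ^ n)) (*-identityʳ c) k≤ , approx

-- Rounded weights with an exact total.

sum-≤-scale : ∀ {n} c N (x y : Fin n → ℕ) → (∀ i → c * x i ≤ c * y i + N) → c * ℕΣ.sum x ≤ c * ℕΣ.sum y + n * N
sum-≤-scale {zero}  c N x y h = m≤m+n (c * 0) 0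
sum-≤-scale {suc n} c N x y h = begin
  c * (x zero + ℕΣ.sum (x ∘ suc))                          ≡⟨ *-distribˡ-+ c (x zero) _ ⟩
  c * x zero + c * ℕΣ.sum (x ∘ suc)                        ≤⟨ +-mono-≤ (h zero) (sum-≤-scale c N (x ∘ suc) (y ∘ suc) (h ∘ suc)) ⟩
  (c * y zero + N) + (c * ℕΣ.sum (y ∘ suc) + n * N)        ≡⟨ lem c (y zero) N (ℕΣ.sum (y ∘ suc)) n ⟩
  c * (y zero + ℕΣ.sum (y ∘ suc)) + suc n * N              ∎
  where
  open ≤-Reasoning
  lem : ∀ c y N s n → (c * y + N) + (c * s + n * N) ≡ c * (y + s) + suc n * N
  lem = ℕ-solve-∀

-- After division, `x ≤ y + n / (n + 1) < y + 1`, and integrality removes the error.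
≤-from-scaled : ∀ n N .{{_ : NonZero N}} x y → suc n * (x * N) ≤ suc n * (y * N) + n * N → x ≤ y
≤-from-scaled n N x y h = ≤-pred (*-cancelˡ-< (suc n) x (suc y) (begin-strict
  suc n * x      ≤⟨ *-cancelʳ-≤ _ _ N (subst₂ _≤_ (lem₁ n x N) (lem₂ n y N) h) ⟩
  suc n * y + n  <⟨ +-monoʳ-< (suc n * y) (n<1+n n) ⟩
  suc n * y + suc n ≡⟨ lem₃ n y ⟩
  suc n * suc y  ∎))
  where
  open ≤-Reasoning
  lem₁ : ∀ n x N → suc n * (x * N) ≡ suc n * x * N
  lem₁ = ℕ-solve-∀
  lem₂ : ∀ n y N → suc n * (y * N) + n * N ≡ (suc n * y + n) * N
  lem₂ = ℕ-solve-∀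
  lem₃ : ∀ n y → suc n * y + suc n ≡ suc n * suc y
  lem₃ = ℕ-solve-∀

-- The weights `a i / N` sum to 1, so `k` times them sum to `k`. With precision `1 / (n + 1)` for
-- each of `n` weights, the total error is below 1, which forces the integers `ℕΣ.sum m` and `k` to
-- agree.
floors-sum : ∀ {n} N .{{_ : NonZero N}} (a : Fin n → ℕ) → ℕΣ.sum a ≡ N →
  ∃ λ k → 1 ≤ k × k ≤ suc n ^ (2 ^ n) × ∃ λ (m : Fin n → ℕ) → ℕΣ.sum m ≡ k × (∀ i → m i * N ≤ suc k * a i)
floors-sum {n} N a Σa≡N =
  let k , 1≤k , k≤ , approx = simultaneous-approx N (suc n) (s≤s z≤n) a
      m = proj₁ ∘ approx
      Σka : ℕΣ.sum (λ i → k * a i) ≡ k * N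
      Σka = trans (sym (ℕΣ.*-distribˡ-sum k a)) (cong (k *_) Σa≡N)
      Σmn : ℕΣ.sum (λ i → m i * N) ≡ ℕΣ.sum m * N
      Σmn = sym (ℕΣ.*-distribʳ-sum N m)
      k≤Σ = ≤-from-scaled n N k (ℕΣ.sum m) (subst₂ (λ u v → suc n * u ≤ suc n * v + n * N) Σka Σmn
              (sum-≤-scale (suc n) N _ _ (λ i → proj₁ (proj₁ (proj₂ (approx i))))))
      Σ≤k = ≤-from-scaled n N (ℕΣ.sum m) k (subst₂ (λ u v → suc n * u ≤ suc n * v + n * N) Σmn Σka
              (sum-≤-scale (suc n) N _ _ (λ i → proj₂ (proj₁ (proj₂ (approx i))))))
  in k , 1≤k , k≤ , m , ≤-antisym Σ≤k k≤Σ , λ i → proj₂ (proj₂ (approx i))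

-- Clearing denominators: integral barycentric coordinates.

toℚᵘ-toℚ : ∀ x → toℚᵘ (toℚ x) ℚᵘ.≃ mkℚᵘ x 0
toℚᵘ-toℚ x = ℚ.toℚᵘ-fromℚᵘ (mkℚᵘ x 0)

toℚ-injective : ∀ {x y} → toℚ x ≡ toℚ y → x ≡ y
toℚ-injective {x} {y} eq with *≡* h ← ℚ.fromℚᵘ-injective {mkℚᵘ x 0} {mkℚᵘ y 0} eq =
  trans (sym (ℤ.*-identityʳ x)) (trans h (ℤ.*-identityʳ y))

toℚ-+ : ∀ x y → toℚ (x ℤ.+ y) ≡ toℚ x ℚ.+ toℚ y
toℚ-+ x y = ℚ.toℚᵘ-injective (begin-equality
  toℚᵘ (toℚ (x ℤ.+ y))             ≃⟨ toℚᵘ-toℚ (x ℤ.+ y) ⟩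
  mkℚᵘ (x ℤ.+ y) 0                 ≃⟨ *≡* (lem x y) ⟩
  mkℚᵘ x 0 ℚᵘ.+ mkℚᵘ y 0           ≃⟨ ℚᵘ.+-cong (toℚᵘ-toℚ x) (toℚᵘ-toℚ y) ⟨
  toℚᵘ (toℚ x) ℚᵘ.+ toℚᵘ (toℚ y)   ≃⟨ ℚ.toℚᵘ-homo-+ (toℚ x) (toℚ y) ⟨
  toℚᵘ (toℚ x ℚ.+ toℚ y)           ∎)
  where
  open ℚᵘ.≤-Reasoning
  lem : ∀ x y → (x ℤ.+ y) ℤ.* (+ 1) ≡ (x ℤ.* + 1 ℤ.+ y ℤ.* + 1) ℤ.* + 1
  lem = ℤ-solve-∀

toℚ-* : ∀ x y → toℚ (x ℤ.* y) ≡ toℚ x ℚ.* toℚ y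
toℚ-* x y = ℚ.toℚᵘ-injective (begin-equality
  toℚᵘ (toℚ (x ℤ.* y))             ≃⟨ toℚᵘ-toℚ (x ℤ.* y) ⟩
  mkℚᵘ (x ℤ.* y) 0                 ≃⟨ *≡* refl ⟩
  mkℚᵘ x 0 ℚᵘ.* mkℚᵘ y 0           ≃⟨ ℚᵘ.*-cong (toℚᵘ-toℚ x) (toℚᵘ-toℚ y) ⟨
  toℚᵘ (toℚ x) ℚᵘ.* toℚᵘ (toℚ y)   ≃⟨ ℚ.toℚᵘ-homo-* (toℚ x) (toℚ y) ⟨
  toℚᵘ (toℚ x ℚ.* toℚ y)           ∎)
  where open ℚᵘ.≤-Reasoning

Clears : ∀ {n} → ℕ → (Fin n → ℕ) → (Fin n → ℚ) → Set
Clears D a μ = ∀ i → toℚ (+ a i) ≡ toℚ (+ suc D) ℚ.* μ i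

toℚ-/ : ∀ a D → toℚ (+ a) ≡ toℚ (+ suc D) ℚ.* (+ a ℚ./ suc D)
toℚ-/ a D = ℚ.toℚᵘ-injective (begin-equality
  toℚᵘ (toℚ (+ a))                                ≃⟨ toℚᵘ-toℚ (+ a) ⟩
  mkℚᵘ (+ a) 0                                    ≃⟨ *≡* (lem (+ a) (+ suc D)) ⟩
  mkℚᵘ (+ suc D) 0 ℚᵘ.* mkℚᵘ (+ a) D              ≃⟨ ℚᵘ.*-cong (toℚᵘ-toℚ (+ suc D)) (ℚ.toℚᵘ-fromℚᵘ (mkℚᵘ (+ a) D)) ⟨
  toℚᵘ (toℚ (+ suc D)) ℚᵘ.* toℚᵘ (+ a ℚ./ suc D)  ≃⟨ ℚ.toℚᵘ-homo-* (toℚ (+ suc D)) (+ a ℚ./ suc D) ⟨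
  toℚᵘ (toℚ (+ suc D) ℚ.* (+ a ℚ./ suc D))        ∎)
  where
  open ℚᵘ.≤-Reasoning
  lem : ∀ x y → x ℤ.* (+ 1 ℤ.* y) ≡ (y ℤ.* x) ℤ.* + 1
  lem = ℤ-solve-∀

clear : ∀ p → 0ℚ ℚ.≤ p → ∃₂ λ D a → toℚ (+ a) ≡ toℚ (+ suc D) ℚ.* p
clear p@(mkℚ (+ a) D _) _ = D , a , trans (toℚ-/ a D) (cong (toℚ (+ suc D) ℚ.*_) (ℚ.↥p/↧p≡p p))
clear (mkℚ -[1+ _ ] _ _) (*≤* ())

clear-all : ∀ {n} (μ : Fin n → ℚ) → (∀ i → 0ℚ ℚ.≤ μ i) → ∃₂ λ D a → Clears D a μ
clear-all {zero}  μ 0≤μ = 0 , (λ ()) , λ ()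
clear-all {suc n} μ 0≤μ with D , x , eq ← clear (μ zero) (0≤μ zero)
                           | E , a , eqs ← clear-all (μ ∘ suc) (0≤μ ∘ suc)
  -- The successor of this number computes to `suc D * suc E`, the common denominator.
  = E ℕ.+ D ℕ.* suc E , b , clears
  where
  open ≡-Reasoning
  DE = toℚ (+ suc D) ℚ.* toℚ (+ suc E)
  toℚ-ℕ* : ∀ m n → toℚ (+ (m ℕ.* n)) ≡ toℚ (+ m) ℚ.* toℚ (+ n)
  toℚ-ℕ* m n = trans (cong toℚ (ℤ.pos-* m n)) (toℚ-* (+ m) (+ n))
  b : Fin (suc n) → ℕ
  b zero    = suc E ℕ.* x
  b (suc i) = suc D ℕ.* a i
  clears : Clears (E ℕ.+ D ℕ.* suc E) b μ
  clears zero = begin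
    toℚ (+ (suc E ℕ.* x))                               ≡⟨ toℚ-ℕ* (suc E) x ⟩
    toℚ (+ suc E) ℚ.* toℚ (+ x)                         ≡⟨ cong (toℚ (+ suc E) ℚ.*_) eq ⟩
    toℚ (+ suc E) ℚ.* (toℚ (+ suc D) ℚ.* μ zero)        ≡⟨ ℚ.*-assoc (toℚ (+ suc E)) (toℚ (+ suc D)) (μ zero) ⟨
    toℚ (+ suc E) ℚ.* toℚ (+ suc D) ℚ.* μ zero          ≡⟨ cong (ℚ._* μ zero) (ℚ.*-comm (toℚ (+ suc E)) (toℚ (+ suc D))) ⟩
    DE ℚ.* μ zero                                       ≡⟨ cong (ℚ._* μ zero) (toℚ-ℕ* (suc D) (suc E)) ⟨
    toℚ (+ (suc D ℕ.* suc E)) ℚ.* μ zero                ∎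
  clears (suc i) = begin
    toℚ (+ (suc D ℕ.* a i))                             ≡⟨ toℚ-ℕ* (suc D) (a i) ⟩
    toℚ (+ suc D) ℚ.* toℚ (+ a i)                       ≡⟨ cong (toℚ (+ suc D) ℚ.*_) (eqs i) ⟩
    toℚ (+ suc D) ℚ.* (toℚ (+ suc E) ℚ.* μ (suc i))     ≡⟨ ℚ.*-assoc (toℚ (+ suc D)) (toℚ (+ suc E)) (μ (suc i)) ⟨
    DE ℚ.* μ (suc i)                                    ≡⟨ cong (ℚ._* μ (suc i)) (toℚ-ℕ* (suc D) (suc E)) ⟨
    toℚ (+ (suc D ℕ.* suc E)) ℚ.* μ (suc i)             ∎

sumℚ-cong : ∀ {n} {f g : Fin n → ℚ} → (∀ i → f i ≡ g i) → sumℚ f ≡ sumℚ g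
sumℚ-cong {zero}  h = refl
sumℚ-cong {suc n} h = cong₂ ℚ._+_ (h zero) (sumℚ-cong (h ∘ suc))

weighted : ∀ {n} → (Fin n → ℕ) → (Fin n → ℤ) → ℤ
weighted a g = ℤΣ.sum (λ i → + a i ℤ.* g i)

clears-weighted : ∀ {n} D (a : Fin n → ℕ) μ g → Clears D a μ →
  toℚ (weighted a g) ≡ toℚ (+ suc D) ℚ.* sumℚ (λ i → μ i ℚ.* toℚ (g i))
clears-weighted {zero}  D a μ g cl = sym (ℚ.*-zeroʳ (toℚ (+ suc D)))
clears-weighted {suc n} D a μ g cl = begin
  toℚ (+ a zero ℤ.* g zero ℤ.+ weighted (a ∘ suc) (g ∘ suc))          ≡⟨ toℚ-+ (+ a zero ℤ.* g zero) (weighted (a ∘ suc) (g ∘ suc)) ⟩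
  toℚ (+ a zero ℤ.* g zero) ℚ.+ toℚ (weighted (a ∘ suc) (g ∘ suc))    ≡⟨ cong₂ ℚ._+_ head≡ (clears-weighted D (a ∘ suc) (μ ∘ suc) (g ∘ suc) (cl ∘ suc)) ⟩
  N ℚ.* (μ zero ℚ.* toℚ (g zero)) ℚ.+ N ℚ.* sumℚ (λ i → μ (suc i) ℚ.* toℚ (g (suc i))) ≡⟨ ℚ.*-distribˡ-+ N _ _ ⟨
  N ℚ.* sumℚ (λ i → μ i ℚ.* toℚ (g i))                                ∎
  where
  open ≡-Reasoning
  N = toℚ (+ suc D)
  head≡ : toℚ (+ a zero ℤ.* g zero) ≡ N ℚ.* (μ zero ℚ.* toℚ (g zero))
  head≡ = begin
    toℚ (+ a zero ℤ.* g zero)           ≡⟨ toℚ-* (+ a zero) (g zero) ⟩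
    toℚ (+ a zero) ℚ.* toℚ (g zero)     ≡⟨ cong (ℚ._* toℚ (g zero)) (cl zero) ⟩
    N ℚ.* μ zero ℚ.* toℚ (g zero)       ≡⟨ ℚ.*-assoc N (μ zero) (toℚ (g zero)) ⟩
    N ℚ.* (μ zero ℚ.* toℚ (g zero))     ∎

-- Homogenising p to (1 , p) turns D p = Σ aᵢ Bᵢ and D = Σ aᵢ into a single condition.
hom : ∀ {d} → Point d → Fin (suc d) → ℤ
hom p = lookup (+ 1 ∷ p)

-- The barycentric coordinates of p are a i / suc D.
record InConvℕ {d} (B : Fin (suc d) → Point d) (p : Point d) : Set where
  constructor barycentric
  field
    D    : ℕ
    a    : Fin (suc d) → ℕ
    bary : ∀ j → + suc D ℤ.* hom p j ≡ weighted a (λ i → hom (B i) j)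

InConv⇒InConvℕ : ∀ {d} {B : Fin (suc d) → Point d} {p} → InConv B p → InConvℕ B p
InConv⇒InConvℕ {d} {B} {p} (μ , 0≤μ , Σμ≡1 , coords)
  with D , a , cl ← clear-all μ 0≤μ = barycentric D a bary
  where
  coords′ : ∀ j → toℚ (hom p j) ≡ sumℚ (λ i → μ i ℚ.* toℚ (hom (B i) j))
  coords′ zero    = trans (sym Σμ≡1) (sumℚ-cong (λ i → sym (ℚ.*-identityʳ (μ i))))
  coords′ (suc j) = coords j
  bary : ∀ j → + suc D ℤ.* hom p j ≡ weighted a (λ i → hom (B i) j)
  bary j = toℚ-injective (trans (toℚ-* (+ suc D) (hom p j))
    (trans (cong (toℚ (+ suc D) ℚ.*_) (coords′ j)) (sym (clears-weighted D a μ (λ i → hom (B i) j) cl))))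

InConvℕ⇒InConv : ∀ {d} {B : Fin (suc d) → Point d} {p} → InConvℕ B p → InConv B p
InConvℕ⇒InConv {d} {B} {p} (barycentric D a bary) =
  μ , (λ i → ℚ.nonNegative⁻¹ (μ i) {{ℚ.normalize-nonNeg (a i) (suc D)}}) ,
  -- The homogenising coordinate of `bary` is what makes the coefficients sum to 1.
  sym (trans (coords zero) (sumℚ-cong {f = λ i → μ i ℚ.* 1ℚ} {μ} (λ i → ℚ.*-identityʳ (μ i)))) , coords ∘ suc
  where
  open ≡-Reasoning
  μ : Fin (suc d) → ℚ
  μ i = + a i ℚ./ suc D
  N N⁻¹ : ℚ
  N = toℚ (+ suc D)
  N⁻¹ = + 1 ℚ./ suc D
  N⁻¹*N : N⁻¹ ℚ.* N ≡ 1ℚ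
  N⁻¹*N = trans (ℚ.*-comm N⁻¹ N) (sym (toℚ-/ 1 D))
  cancel : ∀ x → N⁻¹ ℚ.* (N ℚ.* x) ≡ x
  cancel x = trans (sym (ℚ.*-assoc N⁻¹ N x)) (trans (cong (ℚ._* x) N⁻¹*N) (ℚ.*-identityˡ x))
  coords : ∀ j → toℚ (hom p j) ≡ sumℚ (λ i → μ i ℚ.* toℚ (hom (B i) j))
  coords j = begin
    toℚ (hom p j)                                 ≡⟨ cancel _ ⟨
    N⁻¹ ℚ.* (N ℚ.* toℚ (hom p j))                 ≡⟨ cong (N⁻¹ ℚ.*_) (toℚ-* (+ suc D) (hom p j)) ⟨
    N⁻¹ ℚ.* toℚ (+ suc D ℤ.* hom p j)             ≡⟨ cong (λ z → N⁻¹ ℚ.* toℚ z) (bary j) ⟩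
    N⁻¹ ℚ.* toℚ (weighted a (λ i → hom (B i) j))  ≡⟨ cong (N⁻¹ ℚ.*_) (clears-weighted D a μ (λ i → hom (B i) j) (λ i → toℚ-/ (a i) D)) ⟩
    N⁻¹ ℚ.* (N ℚ.* sumℚ (λ i → μ i ℚ.* toℚ (hom (B i) j)))                        ≡⟨ cancel _ ⟩
    sumℚ (λ i → μ i ℚ.* toℚ (hom (B i) j))        ∎

-- Weighted sums; vertices and midpoints lie in the simplex.

lookup-ext : ∀ {A : Set} {n} {p q : Vec A n} → (∀ j → lookup p j ≡ lookup q j) → p ≡ q
lookup-ext {p = p} {q} h =
  trans (sym (Vec.tabulate∘lookup p)) (trans (Vec.tabulate-cong h) (Vec.tabulate∘lookup q))

weighted-cong : ∀ {n} {a a′ : Fin n → ℕ} g → (∀ i → a i ≡ a′ i) → weighted a g ≡ weighted a′ g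
weighted-cong g h = ℤΣ.sum-cong-≗ (λ i → cong (λ x → + x ℤ.* g i) (h i))

weighted-+ : ∀ {n} (a a′ : Fin n → ℕ) g → weighted (λ i → a i ℕ.+ a′ i) g ≡ weighted a g ℤ.+ weighted a′ g
weighted-+ a a′ g = trans
  (ℤΣ.sum-cong-≗ (λ i → ℤ.*-distribʳ-+ (g i) (+ a i) (+ a′ i)))
  (ℤΣ.∑-distrib-+ (λ i → + a i ℤ.* g i) (λ i → + a′ i ℤ.* g i))

weighted-scale : ∀ {n} c (a : Fin n → ℕ) g → weighted (λ i → c ℕ.* a i) g ≡ + c ℤ.* weighted a g
weighted-scale c a g = trans
  (ℤΣ.sum-cong-≗ (λ i → trans (cong (ℤ._* g i) (ℤ.pos-* c (a i))) (ℤ.*-assoc (+ c) (+ a i) (g i))))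
  (sym (ℤΣ.*-distribˡ-sum (+ c) (λ i → + a i ℤ.* g i)))

weighted-one : ∀ {n} (a : Fin n → ℕ) → weighted a (λ _ → + 1) ≡ + ℕΣ.sum a
weighted-one {zero}  a = refl
weighted-one {suc n} a = cong₂ ℤ._+_ (ℤ.*-identityʳ (+ a zero)) (weighted-one (a ∘ suc))

weighted-zero : ∀ {n} (a : Fin n → ℕ) g → (∀ i → g i ≡ + 0) → weighted a g ≡ + 0
weighted-zero {zero}  a g h = refl
weighted-zero {suc n} a g h = cong₂ ℤ._+_
  (trans (cong (+ a zero ℤ.*_) (h zero)) (ℤ.*-zeroʳ (+ a zero)))
  (weighted-zero (a ∘ suc) (g ∘ suc) (h ∘ suc))

indicator : ∀ {n} → Fin n → Fin n → ℕ
indicator zero    zero    = 1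
indicator zero    (suc _) = 0
indicator (suc _) zero    = 0
indicator (suc i) (suc j) = indicator i j

weighted-indicator : ∀ {n} (i : Fin n) g → weighted (indicator i) g ≡ g i
weighted-indicator {suc n} zero g = begin
  + 1 ℤ.* g zero ℤ.+ weighted (λ _ → 0) (g ∘ suc)  ≡⟨ cong₂ ℤ._+_ (ℤ.*-identityˡ (g zero)) (ℤΣ.sum-replicate-zero n) ⟩
  g zero ℤ.+ + 0                                   ≡⟨ ℤ.+-identityʳ (g zero) ⟩
  g zero                                           ∎
  where open ≡-Reasoning
weighted-indicator (suc i) g =
  trans (ℤ.+-identityˡ (weighted (indicator i) (g ∘ suc))) (weighted-indicator i (g ∘ suc))

vertex-inConv : ∀ {d} (B : Fin (suc d) → Point d) i → InConvℕ B (B i)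
vertex-inConv B i = barycentric 0 (indicator i) λ j →
  trans (ℤ.*-identityˡ (hom (B i) j)) (sym (weighted-indicator i (λ i → hom (B i) j)))

midpoint-inConv : ∀ {d} {B : Fin (suc d) → Point d} {p q r} → InConvℕ B p → InConvℕ B q →
  (∀ j → lookup p j ℤ.+ lookup q j ≡ + 2 ℤ.* lookup r j) → InConvℕ B r
midpoint-inConv {d} {B} {p} {q} {r} (barycentric D a bary-p) (barycentric E a′ bary-q) mid =
  -- The successor computes to `suc D * suc E * 2`: a common denominator for `p` and `q`, doubled
  -- for the midpoint.
  barycentric (suc ((E ℕ.+ D ℕ.* suc E) ℕ.* 2)) a+a′ bary
  where
  open ≡-Reasoning
  hom-mid : ∀ j → hom p j ℤ.+ hom q j ≡ + 2 ℤ.* hom r j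
  hom-mid zero    = refl
  hom-mid (suc j) = mid j
  a+a′ : Fin (suc d) → ℕ
  a+a′ i = suc E ℕ.* a i ℕ.+ suc D ℕ.* a′ i
  N M : ℤ
  N = + suc D
  M = + suc E
  lem₁ : ∀ N M z → N ℤ.* M ℤ.* + 2 ℤ.* z ≡ N ℤ.* M ℤ.* (+ 2 ℤ.* z)
  lem₁ = ℤ-solve-∀
  lem₂ : ∀ N M x y → N ℤ.* M ℤ.* (x ℤ.+ y) ≡ M ℤ.* (N ℤ.* x) ℤ.+ N ℤ.* (M ℤ.* y)
  lem₂ = ℤ-solve-∀
  bary : ∀ j → + (suc D ℕ.* suc E ℕ.* 2) ℤ.* hom r j ≡ weighted a+a′ (λ i → hom (B i) j)
  bary j = begin
    + (suc D ℕ.* suc E ℕ.* 2) ℤ.* hom r j        ≡⟨ lem₁ N M (hom r j) ⟩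
    N ℤ.* M ℤ.* (+ 2 ℤ.* hom r j)                ≡⟨ cong (N ℤ.* M ℤ.*_) (hom-mid j) ⟨
    N ℤ.* M ℤ.* (hom p j ℤ.+ hom q j)            ≡⟨ lem₂ N M (hom p j) (hom q j) ⟩
    M ℤ.* (N ℤ.* hom p j) ℤ.+ N ℤ.* (M ℤ.* hom q j)  ≡⟨ cong₂ (λ x y → M ℤ.* x ℤ.+ N ℤ.* y) (bary-p j) (bary-q j) ⟩
    M ℤ.* weighted a g ℤ.+ N ℤ.* weighted a′ g   ≡⟨ cong₂ ℤ._+_ (weighted-scale (suc E) a g) (weighted-scale (suc D) a′ g) ⟨
    weighted (λ i → suc E ℕ.* a i) g ℤ.+ weighted (λ i → suc D ℕ.* a′ i) g  ≡⟨ weighted-+ (λ i → suc E ℕ.* a i) (λ i → suc D ℕ.* a′ i) g ⟨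
    weighted a+a′ g  ∎
    where
    g : Fin (suc d) → ℤ
    g i = hom (B i) j

-- Splitting several copies of a point into vertices and one leftover lattice point.

scaleBound : ℕ → ℕ
scaleBound d = suc (suc d) ℕ.^ (2 ℕ.^ suc d)

module Peel {d} (B : Fin (suc d) → Point d) (p : Point d) (D : ℕ) (a : Fin (suc d) → ℕ)
  (bary : ∀ j → + suc D ℤ.* hom p j ≡ weighted a (λ i → hom (B i) j))
  (k : ℕ) (m : Fin (suc d) → ℕ) (Σm≡k : ℕΣ.sum m ≡ k) (floor : ∀ i → m i ℕ.* suc D ≤ suc k ℕ.* a i)
  where
  open ≡-Reasoning
  vertices : Fin (suc d) → Fin (suc d) → ℤ
  vertices j i = hom (B i) j
  -- The leftover point, integral by construction; what needs proof is that it lies in the simplex.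
  s : Point d
  s = tabulate (λ j → + suc k ℤ.* lookup p j ℤ.- weighted m (vertices (suc j)))
  lem₁ : ∀ x y → x ≡ (x ℤ.- y) ℤ.+ y
  lem₁ = ℤ-solve-∀
  -- At coordinate `zero` this reads `k + 1 = 1 + k`, which is where `Σm≡k` enters: removing exactly
  -- `k` vertices leaves total weight 1.
  hom-s : ∀ j → + suc k ℤ.* hom p j ≡ hom s j ℤ.+ weighted m (vertices j)
  hom-s zero = begin
    + suc k ℤ.* + 1                      ≡⟨ ℤ.*-identityʳ (+ suc k) ⟩
    + suc k                              ≡⟨ cong (λ x → + suc x) Σm≡k ⟨
    + 1 ℤ.+ + ℕΣ.sum m                   ≡⟨ cong (λ z → + 1 ℤ.+ z) (weighted-one m) ⟨
    + 1 ℤ.+ weighted m (λ _ → + 1)       ∎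
  hom-s (suc j) = begin
    + suc k ℤ.* lookup p j                                           ≡⟨ lem₁ _ (weighted m (vertices (suc j))) ⟩
    (+ suc k ℤ.* lookup p j ℤ.- weighted m (vertices (suc j))) ℤ.+ weighted m (vertices (suc j))
                                                                     ≡⟨ cong (ℤ._+ weighted m (vertices (suc j))) (Vec.lookup∘tabulate _ j) ⟨
    lookup s j ℤ.+ weighted m (vertices (suc j))                     ∎
  -- The numerators of `s` over the old denominator. By `floor` the truncated subtraction is exact.
  a′ : Fin (suc d) → ℕ
  a′ i = suc k ℕ.* a i ℕ.∸ m i ℕ.* suc D
  a′+ : ∀ i → a′ i ℕ.+ suc D ℕ.* m i ≡ suc k ℕ.* a i
  a′+ i = trans (cong (a′ i ℕ.+_) (ℕ.*-comm (suc D) (m i))) (ℕ.m∸n+n≡m (floor i))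
  lem₂ : ∀ D s W → D ℤ.* s ℤ.+ D ℤ.* W ≡ D ℤ.* (s ℤ.+ W)
  lem₂ = ℤ-solve-∀
  lem₃ : ∀ D K x → D ℤ.* (K ℤ.* x) ≡ K ℤ.* (D ℤ.* x)
  lem₃ = ℤ-solve-∀
  bary-s : ∀ j → + suc D ℤ.* hom s j ≡ weighted a′ (vertices j)
  bary-s j = ∙-cancelʳ ℤ.+-0-abelianGroup (+ suc D ℤ.* W) _ _ (begin
    + suc D ℤ.* hom s j ℤ.+ + suc D ℤ.* W           ≡⟨ lem₂ (+ suc D) (hom s j) W ⟩
    + suc D ℤ.* (hom s j ℤ.+ W)                     ≡⟨ cong (+ suc D ℤ.*_) (hom-s j) ⟨
    + suc D ℤ.* (+ suc k ℤ.* hom p j)               ≡⟨ lem₃ (+ suc D) (+ suc k) (hom p j) ⟩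
    + suc k ℤ.* (+ suc D ℤ.* hom p j)               ≡⟨ cong (+ suc k ℤ.*_) (bary j) ⟩
    + suc k ℤ.* weighted a (vertices j)             ≡⟨ weighted-scale (suc k) a (vertices j) ⟨
    weighted (λ i → suc k ℕ.* a i) (vertices j)     ≡⟨ weighted-cong (vertices j) a′+ ⟨
    weighted (λ i → a′ i ℕ.+ suc D ℕ.* m i) (vertices j) ≡⟨ weighted-+ a′ (λ i → suc D ℕ.* m i) (vertices j) ⟩
    weighted a′ (vertices j) ℤ.+ weighted (λ i → suc D ℕ.* m i) (vertices j) ≡⟨ cong (λ z → weighted a′ (vertices j) ℤ.+ z) (weighted-scale (suc D) m (vertices j)) ⟩
    weighted a′ (vertices j) ℤ.+ + suc D ℤ.* W      ∎)
    where W = weighted m (vertices j)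

  s-inConv : InConvℕ B s
  s-inConv = barycentric D a′ bary-s

-- The trade behind replacement (a). As `1 ≤ k`, at least two copies of `p` are used up, while `s`
-- is the only resulting point that may lie outside B.
peel-vertices : ∀ {d} {B : Fin (suc d) → Point d} {p} → InConvℕ B p →
  ∃ λ k → 1 ≤ k × k ≤ scaleBound d × ∃₂ λ m s → InConvℕ B s ×
    (∀ j → + suc k ℤ.* lookup p j ≡ lookup s j ℤ.+ weighted m (λ i → lookup (B i) j))
peel-vertices {d} {B} {p} (barycentric D a bary) =
  -- There are `d + 1` weights, so the bound `suc n ^ (2 ^ n)` becomes `scaleBound d`.
  let k , 1≤k , k≤ , m , Σm≡k , floor = floors-sum (suc D) a
        (ℤ.+-injective (trans (sym (weighted-one a)) (trans (sym (bary zero)) (ℤ.*-identityʳ (+ suc D)))))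
      open Peel B p D a bary k m Σm≡k floor
  in k , 1≤k , k≤ , m , s , s-inConv , hom-s ∘ suc

-- Midpoints of points congruent mod 2, and squared norms.

halve : ℤ → ℤ → ℤ
halve x y = x /ℕ 2 ℤ.+ y /ℕ 2 ℤ.+ + (x %ℕ 2)

halve-spec : ∀ x y → x %ℕ 2 ≡ y %ℕ 2 → x ℤ.+ y ≡ + 2 ℤ.* halve x y
halve-spec x y eq = begin
  x ℤ.+ y                                    ≡⟨ cong₂ ℤ._+_ (ℤ.a≡a%ℕn+[a/ℕn]*n x 2) (ℤ.a≡a%ℕn+[a/ℕn]*n y 2) ⟩
  (+ (x %ℕ 2) ℤ.+ x /ℕ 2 ℤ.* + 2) ℤ.+ (+ (y %ℕ 2) ℤ.+ y /ℕ 2 ℤ.* + 2)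
                                             ≡⟨ cong (λ r → (+ (x %ℕ 2) ℤ.+ x /ℕ 2 ℤ.* + 2) ℤ.+ (+ r ℤ.+ y /ℕ 2 ℤ.* + 2)) eq ⟨
  (+ (x %ℕ 2) ℤ.+ x /ℕ 2 ℤ.* + 2) ℤ.+ (+ (x %ℕ 2) ℤ.+ y /ℕ 2 ℤ.* + 2)
                                             ≡⟨ lem (+ (x %ℕ 2)) (x /ℕ 2) (y /ℕ 2) ⟩
  + 2 ℤ.* halve x y                          ∎
  where
  open ≡-Reasoning
  lem : ∀ r a b → (r ℤ.+ a ℤ.* + 2) ℤ.+ (r ℤ.+ b ℤ.* + 2) ≡ + 2 ℤ.* (a ℤ.+ b ℤ.+ r)
  lem = ℤ-solve-∀

-- The residue class mod 2, coded in `Fin (2 ^ d)` so that the pigeonhole principle applies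
-- directly.
parity : ∀ {d} → Point d → Fin (2 ℕ.^ d)
parity []      = zero
parity (x ∷ p) = combine (fromℕ< (ℤ.n%ℕd<d x 2)) (parity p)

midpoint : ∀ {d} → Point d → Point d → Point d
midpoint = Vec.zipWith halve

midpoint-spec : ∀ {d} (p q : Point d) → parity p ≡ parity q →
  ∀ j → lookup p j ℤ.+ lookup q j ≡ + 2 ℤ.* lookup (midpoint p q) j
midpoint-spec (x ∷ p) (y ∷ q) eq j
  with eqx , eqp ← combine-injective (fromℕ< (ℤ.n%ℕd<d x 2)) (parity p) (fromℕ< (ℤ.n%ℕd<d y 2)) (parity q) eq
  with j
... | zero  = halve-spec x y (trans (sym (toℕ-fromℕ< _)) (trans (cong toℕ eqx) (toℕ-fromℕ< _)))
... | suc j = midpoint-spec p q eqp j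

square : ℤ → ℕ
square x = ∣ x ∣ ℕ.* ∣ x ∣

normSq : ∀ {d} → Point d → ℕ
normSq []      = 0
normSq (x ∷ p) = square x ℕ.+ normSq p

+square : ∀ x → + square x ≡ x ℤ.* x
+square (+ n)    = ℤ.pos-* n n
+square -[1+ n ] = refl

-- The parallelogram law, after substituting `y = 2r − x`.
square-midpoint : ∀ x y r → x ℤ.+ y ≡ + 2 ℤ.* r →
  square x ℕ.+ square y ≡ 2 ℕ.* square r ℕ.+ 2 ℕ.* square (x ℤ.- r)
square-midpoint x y r eq = ℤ.+-injective (begin
  + square x ℤ.+ + square y                                 ≡⟨ cong₂ ℤ._+_ (+square x) (+square y) ⟩
  x ℤ.* x ℤ.+ y ℤ.* y                                       ≡⟨ cong (λ z → x ℤ.* x ℤ.+ z ℤ.* z) y≡ ⟩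
  x ℤ.* x ℤ.+ (+ 2 ℤ.* r ℤ.- x) ℤ.* (+ 2 ℤ.* r ℤ.- x)       ≡⟨ lem₂ x r ⟩
  + 2 ℤ.* (r ℤ.* r) ℤ.+ + 2 ℤ.* ((x ℤ.- r) ℤ.* (x ℤ.- r))   ≡⟨ cong₂ (λ u v → + 2 ℤ.* u ℤ.+ + 2 ℤ.* v) (+square r) (+square (x ℤ.- r)) ⟨
  + 2 ℤ.* + square r ℤ.+ + 2 ℤ.* + square (x ℤ.- r)         ≡⟨ cong₂ ℤ._+_ (ℤ.pos-* 2 (square r)) (ℤ.pos-* 2 (square (x ℤ.- r))) ⟨
  + (2 ℕ.* square r ℕ.+ 2 ℕ.* square (x ℤ.- r))             ∎)
  where
  open ≡-Reasoning
  lem₁ : ∀ x y → y ≡ (x ℤ.+ y) ℤ.- x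
  lem₁ = ℤ-solve-∀
  lem₂ : ∀ x r → x ℤ.* x ℤ.+ (+ 2 ℤ.* r ℤ.- x) ℤ.* (+ 2 ℤ.* r ℤ.- x) ≡ + 2 ℤ.* (r ℤ.* r) ℤ.+ + 2 ℤ.* ((x ℤ.- r) ℤ.* (x ℤ.- r))
  lem₂ = ℤ-solve-∀
  y≡ : y ≡ + 2 ℤ.* r ℤ.- x
  y≡ = trans (lem₁ x y) (cong (ℤ._- x) eq)

normSq-midpoint : ∀ {d} (p q r : Point d) → (∀ j → lookup p j ℤ.+ lookup q j ≡ + 2 ℤ.* lookup r j) →
  normSq p ℕ.+ normSq q ≡ 2 ℕ.* normSq r ℕ.+ 2 ℕ.* normSq (Vec.zipWith ℤ._-_ p r)
normSq-midpoint []      []      []      h = refl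
normSq-midpoint (x ∷ p) (y ∷ q) (z ∷ r) h = begin
  (square x ℕ.+ normSq p) ℕ.+ (square y ℕ.+ normSq q)   ≡⟨ lem₁ (square x) (normSq p) (square y) (normSq q) ⟩
  (square x ℕ.+ square y) ℕ.+ (normSq p ℕ.+ normSq q)   ≡⟨ cong₂ ℕ._+_ (square-midpoint x y z (h zero)) (normSq-midpoint p q r (h ∘ suc)) ⟩
  (2 ℕ.* square z ℕ.+ 2 ℕ.* square (x ℤ.- z)) ℕ.+ (2 ℕ.* normSq r ℕ.+ 2 ℕ.* D)  ≡⟨ lem₂ (square z) (square (x ℤ.- z)) (normSq r) D ⟩
  2 ℕ.* (square z ℕ.+ normSq r) ℕ.+ 2 ℕ.* (square (x ℤ.- z) ℕ.+ D)  ∎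
  where
  open ≡-Reasoning
  D = normSq (Vec.zipWith ℤ._-_ p r)
  lem₁ : ∀ a b c d → (a ℕ.+ b) ℕ.+ (c ℕ.+ d) ≡ (a ℕ.+ c) ℕ.+ (b ℕ.+ d)
  lem₁ = ℕ-solve-∀
  lem₂ : ∀ a b c d → (2 ℕ.* a ℕ.+ 2 ℕ.* b) ℕ.+ (2 ℕ.* c ℕ.+ 2 ℕ.* d) ≡ 2 ℕ.* (a ℕ.+ c) ℕ.+ 2 ℕ.* (b ℕ.+ d)
  lem₂ = ℕ-solve-∀

normSq-diff-zero : ∀ {d} (p r : Point d) → normSq (Vec.zipWith ℤ._-_ p r) ≡ 0 → p ≡ r
normSq-diff-zero []      []      _ = refl
normSq-diff-zero (x ∷ p) (z ∷ r) h = cong₂ _∷_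
  (ℤ.i-j≡0⇒i≡j x z (square-zero (x ℤ.- z) (ℕ.m+n≡0⇒m≡0 (square (x ℤ.- z)) h)))
  (normSq-diff-zero p r (ℕ.m+n≡0⇒n≡0 (square (x ℤ.- z)) h))
  where
  square-zero : ∀ x → square x ≡ 0 → x ≡ + 0
  square-zero (+ zero) _ = refl

-- The gap between the two sides is `2|p − r|²`. It vanishes only for `p ≡ r`, and then `q = 2r − p`
-- equals `r` as well.
normSq-midpoint-< : ∀ {d} (p q r : Point d) → (∀ j → lookup p j ℤ.+ lookup q j ≡ + 2 ℤ.* lookup r j) →
  p ≢ q → 2 ℕ.* normSq r < normSq p ℕ.+ normSq q
normSq-midpoint-< p q r mid p≢q with normSq (Vec.zipWith ℤ._-_ p r) in eq | normSq-midpoint p q r mid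
... | suc D | h = subst (2 ℕ.* normSq r <_) (sym h) (ℕ.m<m+n (2 ℕ.* normSq r) (s≤s z≤n))
... | zero  | _ = contradiction (trans p≡r (sym q≡r)) p≢q
  where
  open ≡-Reasoning
  p≡r : p ≡ r
  p≡r = normSq-diff-zero p r eq
  lem : ∀ x y → y ≡ (x ℤ.+ y) ℤ.- x
  lem = ℤ-solve-∀
  lem′ : ∀ x → + 2 ℤ.* x ℤ.- x ≡ x
  lem′ = ℤ-solve-∀
  coord : ∀ j → lookup q j ≡ lookup r j
  coord j = begin
    lookup q j                                    ≡⟨ lem (lookup p j) (lookup q j) ⟩
    (lookup p j ℤ.+ lookup q j) ℤ.- lookup p j    ≡⟨ cong₂ ℤ._-_ (mid j) (cong (λ v → lookup v j) p≡r) ⟩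
    + 2 ℤ.* lookup r j ℤ.- lookup r j             ≡⟨ lem′ (lookup r j) ⟩
    lookup r j                                    ∎
  q≡r : q ≡ r
  q≡r = lookup-ext coord

-- Linear functionals on combinations, and merging of repeated points.

-- The functional is arbitrary so that one identity per replacement yields both the preserved
-- coordinates of the value and the change of each measure.
linear : ∀ {A : Set} → (A → ℤ) → List (A × ℕ) → ℤ
linear f []            = + 0
linear f ((p , k) ∷ L) = + k ℤ.* f p ℤ.+ linear f L

mass : ∀ {A : Set} → (A → ℕ) → List (A × ℕ) → ℕ
mass g []            = 0
mass g ((p , k) ∷ L) = k * g p ℕ.+ mass g L

linear-+ : ∀ {A : Set} (g : A → ℕ) L → linear (+_ ∘ g) L ≡ + mass g L
linear-+ g []            = refl
linear-+ g ((p , k) ∷ L) = cong₂ ℤ._+_ (sym (ℤ.pos-* k (g p))) (linear-+ g L)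

mass-cong : ∀ {A : Set} (g : A → ℕ) L M → (∀ f → linear f L ≡ linear f M) → mass g L ≡ mass g M
mass-cong g L M eq = ℤ.+-injective (trans (sym (linear-+ g L)) (trans (eq (+_ ∘ g)) (linear-+ g M)))

linear-++ : ∀ {A : Set} (f : A → ℤ) L M → linear f (L ++ M) ≡ linear f L ℤ.+ linear f M
linear-++ f []            M = sym (ℤ.+-identityˡ (linear f M))
linear-++ f ((p , k) ∷ L) M =
  trans (cong (λ z → + k ℤ.* f p ℤ.+ z) (linear-++ f L M)) (sym (ℤ.+-assoc (+ k ℤ.* f p) (linear f L) (linear f M)))

linear-↭ : ∀ {A : Set} (f : A → ℤ) {L M} → L ↭ M → linear f L ≡ linear f M
linear-↭ f Perm.refl                     = refl
linear-↭ f (Perm.prep (p , k) σ)         = cong (λ z → + k ℤ.* f p ℤ.+ z) (linear-↭ f σ)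
linear-↭ f (Perm.swap {xs} {ys} (p , k) (q , l) σ) = begin
  x ℤ.+ (y ℤ.+ linear f xs)  ≡⟨ cong (λ z → x ℤ.+ (y ℤ.+ z)) (linear-↭ f σ) ⟩
  x ℤ.+ (y ℤ.+ linear f ys)  ≡⟨ lem x y (linear f ys) ⟩
  y ℤ.+ (x ℤ.+ linear f ys)  ∎
  where
  open ≡-Reasoning
  x = + k ℤ.* f p
  y = + l ℤ.* f q
  lem : ∀ x y z → x ℤ.+ (y ℤ.+ z) ≡ y ℤ.+ (x ℤ.+ z)
  lem = ℤ-solve-∀
linear-↭ f (Perm.trans σ τ)              = trans (linear-↭ f σ) (linear-↭ f τ)

linear-tabulate : ∀ {A : Set} {n} (f : A → ℤ) (B : Fin n → A) m →
  linear f (List.tabulate (λ i → B i , m i)) ≡ weighted m (f ∘ B)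
linear-tabulate {n = zero}  f B m = refl
linear-tabulate {n = suc n} f B m = cong (λ z → + m zero ℤ.* f (B zero) ℤ.+ z) (linear-tabulate f (B ∘ suc) (m ∘ suc))

lookup-combo : ∀ {d} (L : List (Point d × ℕ)) j → lookup (combo L) j ≡ linear (λ p → lookup p j) L
lookup-combo []            j = Vec.lookup-replicate j (+ 0)
lookup-combo ((p , k) ∷ L) j = trans (Vec.lookup-zipWith ℤ._+_ j (Vec.map (+ k ℤ.*_) p) (combo L))
  (cong₂ ℤ._+_ (Vec.lookup-map j (+ k ℤ.*_) p) (lookup-combo L j))

-- Adding the multiplicities of equal points changes no linear functional, so the value and both
-- measures survive.
merge-keys : ∀ {d} {P : Point d → Set} (L : List (Point d × ℕ)) → All (P ∘ proj₁) L →
  ∃ λ M → Unique (map proj₁ M) × All (P ∘ proj₁) M × (∀ f → linear f L ≡ linear f M)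
merge-keys []            []       = [] , [] , [] , λ _ → refl
merge-keys {P = P} ((p , k) ∷ L) (Pp ∷ PL)
  with M , uniq , PM , L≡M ← merge-keys {P = P} L PL
  with Any.any? (λ e → Vec.≡-dec ℤ._≟_ p (proj₁ e)) M
... | no p∉M = (p , k) ∷ M , All.map⁺ (All.¬Any⇒All¬ M p∉M) ∷ uniq , Pp ∷ PM ,
               λ f → cong (λ z → + k ℤ.* f p ℤ.+ z) (L≡M f)
... | yes p∈M
  with (.p , l) , e∈M , refl ← find p∈M
  with R , M↭ ← extract e∈M
  = (p , k ℕ.+ l) ∷ R , uniq′ , Pp ∷ All.tail (All-resp-↭ M↭ PM) , linear≡
  where
  uniq′ : Unique (p ∷ map proj₁ R)
  uniq′ = Permₛ.Unique-resp-↭ (setoid _) (↭⇒↭ₛ (map⁺ proj₁ M↭)) uniq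
  lem : ∀ k l x r → k ℤ.* x ℤ.+ (l ℤ.* x ℤ.+ r) ≡ (k ℤ.+ l) ℤ.* x ℤ.+ r
  lem = ℤ-solve-∀
  linear≡ : ∀ f → + k ℤ.* f p ℤ.+ linear f L ≡ linear f ((p , k ℕ.+ l) ∷ R)
  linear≡ f = trans (cong (λ z → + k ℤ.* f p ℤ.+ z) (trans (L≡M f) (linear-↭ f M↭))) (lem (+ k) (+ l) (f p) (linear f R))

lookup-AllPairs : ∀ {A : Set} {R : A → A → Set} {xs : List A} → AllPairs R xs →
  ∀ {i j} → i Fin.< j → R (List.lookup xs i) (List.lookup xs j)
lookup-AllPairs {xs = _ ∷ xs} (Rx ∷ _)  {zero}  {suc j} _         = All.lookup Rx (∈-lookup {xs = xs} j)
lookup-AllPairs               (_ ∷ Rxs) {suc i} {suc j} (s≤s i<j) = lookup-AllPairs Rxs i<j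

-- The two replacements and their termination.

module Reduction {d} (B : Fin (suc d) → Point d) where

  outside : Point d → ℕ
  outside p with inB? B p
  ... | yes _ = 0
  ... | no  _ = 1

  outside-no : ∀ {p} → ¬ InB B p → outside p ≡ 1
  outside-no {p} p∉B with inB? B p
  ... | yes p∈B = contradiction p∈B p∉B
  ... | no  _   = refl

  outside-vertex : ∀ i → outside (B i) ≡ 0
  outside-vertex i with inB? B (B i)
  ... | yes _  = refl
  ... | no  ∉B = contradiction (i , refl) ∉B

  outside≤1 : ∀ p → outside p ≤ 1
  outside≤1 p with inB? B p
  ... | yes _ = z≤n
  ... | no  _ = s≤s z≤n

  Combination : Set
  Combination = List (Point d × ℕ)

  InConvs : Combination → Set
  InConvs = All (InConvℕ B ∘ proj₁)

  SameValue : Combination → Combination → Set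
  SameValue L M = ∀ j → linear (λ p → lookup p j) L ≡ linear (λ p → lookup p j) M

  -- Since `k ≤ scaleBound d < c`, there are `k + 1` copies of `s` to trade. The mass outside B
  -- loses `k + 1 ≥ 2` and regains at most 1 from `t`, because vertices contribute nothing.
  shrink-multiplicity : ∀ {L s c} → InConvs L → (s , c) ∈ L → ¬ InB B s → scaleBound d < c →
    ∃ λ M → InConvs M × SameValue L M × mass outside M < mass outside L
  shrink-multiplicity {L} {s} {c} convs e∈L s∉B bound<c =
    let k , 1≤k , k≤ , m , t , t-conv , split = peel-vertices (All.lookup convs e∈L)
        R , L↭ = extract e∈L
        c′ = c ℕ.∸ suc k
        c≡ = ℕ.m+[n∸m]≡n (ℕ.≤-trans (s≤s k≤) bound<c)
        M = (s , c′) ∷ (t , 1) ∷ List.tabulate (λ i → B i , m i) ++ R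
        convs-R : InConvs R
        convs-R = All.tail (All-resp-↭ L↭ convs)
    in M , All.lookup convs e∈L ∷ t-conv ∷ All.++⁺ (All.tabulate⁺ {f = λ i → B i , m i} (vertex-inConv B)) convs-R ,
       value k m t R c′ L↭ c≡ split , less k m t R c′ L↭ c≡ 1≤k
    where
    module _ (k : ℕ) (m : Fin (suc d) → ℕ) (t : Point d) (R : Combination) (c′ : ℕ)
             (L↭ : L ↭ (s , c) ∷ R) (c≡ : suc k ℕ.+ c′ ≡ c) where
      M : Combination
      M = (s , c′) ∷ (t , 1) ∷ List.tabulate (λ i → B i , m i) ++ R
      -- The trade in subtraction-free form. With a coordinate for `f` the traded parts cancel by
      -- `split`; with `outside` it measures the loss.
      balance : ∀ f → linear f L ℤ.+ (f t ℤ.+ weighted m (f ∘ B)) ≡ linear f M ℤ.+ + suc k ℤ.* f s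
      balance f = begin
        linear f L ℤ.+ (f t ℤ.+ W)                        ≡⟨ cong (ℤ._+ (f t ℤ.+ W)) (linear-↭ f L↭) ⟩
        (+ c ℤ.* f s ℤ.+ linear f R) ℤ.+ (f t ℤ.+ W)      ≡⟨ cong (λ c → (+ c ℤ.* f s ℤ.+ linear f R) ℤ.+ (f t ℤ.+ W)) c≡ ⟨
        ((+ suc k ℤ.+ + c′) ℤ.* f s ℤ.+ linear f R) ℤ.+ (f t ℤ.+ W) ≡⟨ lem (+ suc k) (+ c′) (f s) (linear f R) (f t) W ⟩
        (+ c′ ℤ.* f s ℤ.+ (+ 1 ℤ.* f t ℤ.+ (W ℤ.+ linear f R))) ℤ.+ + suc k ℤ.* f s
          ≡⟨ cong (λ w → (+ c′ ℤ.* f s ℤ.+ (+ 1 ℤ.* f t ℤ.+ (w ℤ.+ linear f R))) ℤ.+ + suc k ℤ.* f s) (linear-tabulate f B m) ⟨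
        (+ c′ ℤ.* f s ℤ.+ (+ 1 ℤ.* f t ℤ.+ (linear f T ℤ.+ linear f R))) ℤ.+ + suc k ℤ.* f s
          ≡⟨ cong (λ w → (+ c′ ℤ.* f s ℤ.+ (+ 1 ℤ.* f t ℤ.+ w)) ℤ.+ + suc k ℤ.* f s) (linear-++ f T R) ⟨
        linear f M ℤ.+ + suc k ℤ.* f s                    ∎
        where
        open ≡-Reasoning
        W = weighted m (f ∘ B)
        T = List.tabulate (λ i → B i , m i)
        lem : ∀ k c x r t W → ((k ℤ.+ c) ℤ.* x ℤ.+ r) ℤ.+ (t ℤ.+ W) ≡
              (c ℤ.* x ℤ.+ (+ 1 ℤ.* t ℤ.+ (W ℤ.+ r))) ℤ.+ k ℤ.* x
        lem = ℤ-solve-∀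
      value : (∀ j → + suc k ℤ.* lookup s j ≡ lookup t j ℤ.+ weighted m (λ i → lookup (B i) j)) → SameValue L M
      value split j = ∙-cancelʳ ℤ.+-0-abelianGroup (+ suc k ℤ.* lookup s j) _ _
        (trans (cong (λ z → linear (λ p → lookup p j) L ℤ.+ z) (split j)) (balance (λ p → lookup p j)))
      W≡0 : weighted m (+_ ∘ outside ∘ B) ≡ + 0
      W≡0 = weighted-zero m (+_ ∘ outside ∘ B) (λ i → cong +_ (outside-vertex i))
      massBalance : mass outside L ℕ.+ outside t ≡ mass outside M ℕ.+ suc k * outside s
      massBalance = ℤ.+-injective (begin
        + mass outside L ℤ.+ + outside t  ≡⟨ cong₂ ℤ._+_ (linear-+ outside L) (trans (cong (λ z → + outside t ℤ.+ z) W≡0) (ℤ.+-identityʳ (+ outside t))) ⟨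
        linear (+_ ∘ outside) L ℤ.+ (+ outside t ℤ.+ weighted m (+_ ∘ outside ∘ B)) ≡⟨ balance (+_ ∘ outside) ⟩
        linear (+_ ∘ outside) M ℤ.+ + suc k ℤ.* + outside s ≡⟨ cong₂ ℤ._+_ (linear-+ outside M) (sym (ℤ.pos-* (suc k) (outside s))) ⟩
        + mass outside M ℤ.+ + (suc k * outside s) ∎)
        where open ≡-Reasoning
      less : 1 ≤ k → mass outside M < mass outside L
      less 1≤k = ℕ.+-cancelʳ-< 1 (mass outside M) (mass outside L) (begin-strict
        mass outside M ℕ.+ 1                   <⟨ ℕ.+-monoʳ-< (mass outside M) (s≤s 1≤k) ⟩
        mass outside M ℕ.+ suc k               ≡⟨ cong (mass outside M ℕ.+_) (trans (cong (suc k *_) (outside-no s∉B)) (ℕ.*-identityʳ (suc k))) ⟨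
        mass outside M ℕ.+ suc k * outside s   ≡⟨ massBalance ⟨
        mass outside L ℕ.+ outside t           ≤⟨ ℕ.+-monoʳ-≤ (mass outside L) (outside≤1 t) ⟩
        mass outside L ℕ.+ 1                   ∎)
        where open ℕ.≤-Reasoning

  -- One copy each of `p` and `q` becomes two copies of their midpoint. Two units of mass outside B
  -- go and at most two return, while strict convexity of the squared norm gives the strict
  -- decrease.
  contract-pair : ∀ {L p q c e} → InConvs L → (p , c) ∈ L → (q , e) ∈ L → c ≢ 0 → e ≢ 0 →
    ¬ InB B p → ¬ InB B q → p ≢ q → parity p ≡ parity q →
    ∃ λ M → InConvs M × SameValue L M × mass outside M ≤ mass outside L × mass normSq M < mass normSq L
  contract-pair {c = zero}             _ _ _ c≢0 _ = contradiction refl c≢0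
  contract-pair {c = suc _} {e = zero} _ _ _ _ e≢0 = contradiction refl e≢0
  contract-pair {L} {p} {q} {suc c} {suc e} convs p∈L q∈L _ _ p∉B q∉B p≢q par =
    let R , L↭ = extract p∈L
        S , R↭ = extract (q∈R R L↭)
        pq↭    = Perm.trans L↭ (Perm.prep (p , suc c) R↭)
        convs-S : InConvs S
        convs-S = All.tail (All.tail (All-resp-↭ pq↭ convs))
    in (p , c) ∷ (q , e) ∷ (r , 2) ∷ S ,
       All.lookup convs p∈L ∷ All.lookup convs q∈L ∷ midpoint-inConv (All.lookup convs p∈L) (All.lookup convs q∈L) mid ∷ convs-S ,
       value S pq↭ , outside-≤ S pq↭ , normSq-< S pq↭
    where
    r : Point d
    r = midpoint p q
    mid : ∀ j → lookup p j ℤ.+ lookup q j ≡ + 2 ℤ.* lookup r j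
    mid = midpoint-spec p q par
    q∈R : ∀ R → L ↭ (p , suc c) ∷ R → (q , suc e) ∈ R
    q∈R R L↭ with ∈-resp-↭ L↭ q∈L
    -- As `p ≢ q`, the entry of `q` is not the one already extracted.
    ... | here q≡p   = contradiction (sym (cong proj₁ q≡p)) p≢q
    ... | there q∈R′ = q∈R′
    module _ (S : Combination) (pq↭ : L ↭ (p , suc c) ∷ (q , suc e) ∷ S) where
      M : Combination
      M = (p , c) ∷ (q , e) ∷ (r , 2) ∷ S
      balance : ∀ f → linear f L ℤ.+ + 2 ℤ.* f r ≡ linear f M ℤ.+ (f p ℤ.+ f q)
      balance f = trans (cong (ℤ._+ + 2 ℤ.* f r) (linear-↭ f pq↭)) (lem (+ c) (+ e) (f p) (f q) (f r) (linear f S))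
        where
        lem : ∀ c e p q r s → ((+ 1 ℤ.+ c) ℤ.* p ℤ.+ ((+ 1 ℤ.+ e) ℤ.* q ℤ.+ s)) ℤ.+ + 2 ℤ.* r ≡
              (c ℤ.* p ℤ.+ (e ℤ.* q ℤ.+ (+ 2 ℤ.* r ℤ.+ s))) ℤ.+ (p ℤ.+ q)
        lem = ℤ-solve-∀
      massBalance : ∀ g → mass g L ℕ.+ 2 * g r ≡ mass g M ℕ.+ (g p ℕ.+ g q)
      massBalance g = ℤ.+-injective (begin
        + mass g L ℤ.+ + (2 * g r)                      ≡⟨ cong₂ ℤ._+_ (sym (linear-+ g L)) (ℤ.pos-* 2 (g r)) ⟩
        linear (+_ ∘ g) L ℤ.+ + 2 ℤ.* + g r             ≡⟨ balance (+_ ∘ g) ⟩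
        linear (+_ ∘ g) M ℤ.+ (+ g p ℤ.+ + g q)         ≡⟨ cong (ℤ._+ (+ g p ℤ.+ + g q)) (linear-+ g M) ⟩
        + mass g M ℤ.+ (+ g p ℤ.+ + g q)                ∎)
        where open ≡-Reasoning
      value : SameValue L M
      value j = ∙-cancelʳ ℤ.+-0-abelianGroup (+ 2 ℤ.* lookup r j) _ _
        (trans (balance (λ p → lookup p j)) (cong (λ z → linear (λ p → lookup p j) M ℤ.+ z) (mid j)))
      outside-≤ : mass outside M ≤ mass outside L
      outside-≤ = ℕ.+-cancelʳ-≤ 2 (mass outside M) (mass outside L) (begin
        mass outside M ℕ.+ 2                         ≡⟨ cong (mass outside M ℕ.+_) (cong₂ ℕ._+_ (outside-no p∉B) (outside-no q∉B)) ⟨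
        mass outside M ℕ.+ (outside p ℕ.+ outside q) ≡⟨ massBalance outside ⟨
        mass outside L ℕ.+ 2 * outside r             ≤⟨ ℕ.+-monoʳ-≤ (mass outside L) (ℕ.*-monoʳ-≤ 2 (outside≤1 r)) ⟩
        mass outside L ℕ.+ 2                         ∎)
        where open ℕ.≤-Reasoning
      normSq-< : mass normSq M < mass normSq L
      normSq-< = ℕ.+-cancelʳ-< (2 * normSq r) (mass normSq M) (mass normSq L) (begin-strict
        mass normSq M ℕ.+ 2 * normSq r             <⟨ ℕ.+-monoʳ-< (mass normSq M) (normSq-midpoint-< p q r mid p≢q) ⟩
        mass normSq M ℕ.+ (normSq p ℕ.+ normSq q)  ≡⟨ massBalance normSq ⟨
        mass normSq L ℕ.+ 2 * normSq r             ∎)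
        where open ℕ.≤-Reasoning

  Reduced : Combination → Set
  Reduced L = Unique (map proj₁ L) × InConvs L ×
    All (λ e → ¬ InB B (proj₁ e) → proj₂ e ≤ scaleBound d) L × length (suppOutsideB B L) ≤ 2 ^ d

  -- Pigeonhole on the `2 ^ d` parity classes. Filtering keeps the keys distinct, so two different
  -- positions hold two different points.
  same-parity-pair : ∀ L → Unique (map proj₁ L) → 2 ^ d < length (suppOutsideB B L) →
    ∃₂ λ x y → x ∈ L × y ∈ L × proj₂ x ≢ 0 × proj₂ y ≢ 0 × ¬ InB B (proj₁ x) × ¬ InB B (proj₁ y) ×
      proj₁ x ≢ proj₁ y × parity (proj₁ x) ≡ parity (proj₁ y)
  same-parity-pair L uniq many =
    let outside? = λ (e : Point d × ℕ) → ¬? (proj₂ e ℕ.≟ 0) ×-dec ¬? (inB? B (proj₁ e))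
        F = suppOutsideB B L
        i , j , i<j , par = pigeonhole many (parity ∘ proj₁ ∘ List.lookup F)
        x∈L , x≢0 , x∉B = ∈-filter⁻ outside? {xs = L} (∈-lookup {xs = F} i)
        y∈L , y≢0 , y∉B = ∈-filter⁻ outside? {xs = L} (∈-lookup {xs = F} j)
        distinct = lookup-AllPairs (AllPairs.filter⁺ outside? (AllPairs.map⁻ uniq)) i<j
    in _ , _ , x∈L , y∈L , x≢0 , y≢0 , x∉B , y∉B , distinct , par

  -- Either nothing remains to be done, or replacement (a) or (b) applies, each with the decrease it
  -- guarantees.
  Step : Combination → Set
  Step L = (∃ λ M → Reduced M × SameValue L M)
         ⊎ (∃ λ M → InConvs M × SameValue L M × mass outside M < mass outside L)
         ⊎ (∃ λ M → InConvs M × SameValue L M × mass outside M ≤ mass outside L × mass normSq M < mass normSq L)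

  step-unique : ∀ L → Unique (map proj₁ L) → InConvs L → Step L
  step-unique L uniq convs with Any.any? (λ e → ¬? (inB? B (proj₁ e)) ×-dec scaleBound d ℕ.<? proj₂ e) L
  ... | yes large =
    let _ , e∈L , s∉B , bound<c = find large
    in inj₂ (inj₁ (shrink-multiplicity convs e∈L s∉B bound<c))
  ... | no none with length (suppOutsideB B L) ℕ.≤? 2 ^ d
  ...   | yes few = inj₁ (L , (uniq , convs , small , few) , λ _ → refl)
    where
    small : All (λ e → ¬ InB B (proj₁ e) → proj₂ e ≤ scaleBound d) L
    small = All.map (λ h ∉B → ℕ.≮⇒≥ (λ lt → h (∉B , lt))) (All.¬Any⇒All¬ L none)
  ...   | no ¬few =
    let _ , _ , x∈ , y∈ , x≢0 , y≢0 , x∉B , y∉B , x≢y , par = same-parity-pair L uniq (ℕ.≰⇒> ¬few)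
    in inj₂ (inj₂ (contract-pair convs x∈ y∈ x≢0 y≢0 x∉B y∉B x≢y par))

  -- A replacement may introduce points that already occur, so repeated points are merged before the
  -- next test.
  step : ∀ L → InConvs L → Step L
  step L convs =
    let M , uniq , convs-M , L≡M = merge-keys {P = InConvℕ B} L convs
    in transport M L≡M (step-unique M uniq convs-M)
    where
    transport : ∀ M → (∀ f → linear f L ≡ linear f M) → Step M → Step L
    transport M L≡M (inj₁ (N , red , M≡N)) = inj₁ (N , red , λ j → trans (L≡M (λ p → lookup p j)) (M≡N j))
    transport M L≡M (inj₂ (inj₁ (N , convs-N , M≡N , less))) =
      inj₂ (inj₁ (N , convs-N , (λ j → trans (L≡M (λ p → lookup p j)) (M≡N j)) ,
        subst (mass outside N <_) (sym (mass-cong outside L M L≡M)) less))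
    transport M L≡M (inj₂ (inj₂ (N , convs-N , M≡N , le , less))) =
      inj₂ (inj₂ (N , convs-N , (λ j → trans (L≡M (λ p → lookup p j)) (M≡N j)) ,
        subst (mass outside N ≤_) (sym (mass-cong outside L M L≡M)) le ,
        subst (mass normSq N <_) (sym (mass-cong normSq L M L≡M)) less))

  -- w and n bound the two quantities of the lexicographic measure: the mass outside B, and the total squared norm.
  reduce : ∀ w n L → InConvs L → mass outside L ≤ w → mass normSq L ≤ n → ∃ λ M → Reduced M × SameValue L M
  continue : ∀ w n L → mass outside L ≤ w → mass normSq L ≤ n → Step L → ∃ λ M → Reduced M × SameValue L M

  reduce w n L convs L≤w L≤n = continue w n L L≤w L≤n (step L convs)

  continue w n L L≤w L≤n (inj₁ done) = done
  continue zero n L L≤w L≤n (inj₂ (inj₁ (M , convs , L≡M , less))) = contradiction (ℕ.<-≤-trans less L≤w) ℕ.n≮0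
  -- Replacement (a) may increase the squared norm, so its bound is reset to the current value while
  -- `w` drops.
  continue (suc w) n L L≤w L≤n (inj₂ (inj₁ (M , convs , L≡M , less))) =
    let N , red , M≡N = reduce w (mass normSq M) M convs (ℕ.≤-pred (ℕ.<-≤-trans less L≤w)) ℕ.≤-refl
    in N , red , λ j → trans (L≡M j) (M≡N j)
  continue w zero L L≤w L≤n (inj₂ (inj₂ (M , convs , L≡M , le , less))) = contradiction (ℕ.<-≤-trans less L≤n) ℕ.n≮0
  continue w (suc n) L L≤w L≤n (inj₂ (inj₂ (M , convs , L≡M , le , less))) =
    let N , red , M≡N = reduce w n M convs (ℕ.≤-trans le L≤w) (ℕ.≤-pred (ℕ.<-≤-trans less L≤n))
    in N , red , λ j → trans (L≡M j) (M≡N j)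

-- The double exponential bound and the conclusion.

scaleBound≤ : ∀ d → 1 ≤ d → scaleBound d ≤ 2 ^ (2 ^ (4 * d))
scaleBound≤ d 1≤d = begin
  suc (suc d) ^ (2 ^ suc d)           ≤⟨ ℕ.^-monoˡ-≤ (2 ^ suc d) (n<2^n (suc d)) ⟩
  (2 ^ suc d) ^ (2 ^ suc d)           ≡⟨ ℕ.^-*-assoc 2 (suc d) (2 ^ suc d) ⟩
  2 ^ (suc d * 2 ^ suc d)             ≤⟨ ℕ.^-monoʳ-≤ 2 (ℕ.*-monoˡ-≤ (2 ^ suc d) (ℕ.<⇒≤ (n<2^n (suc d)))) ⟩
  2 ^ (2 ^ suc d * 2 ^ suc d)         ≡⟨ cong (2 ^_) (ℕ.^-distribˡ-+-* 2 (suc d) (suc d)) ⟨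
  -- Here `1 ≤ d` gives `2(d + 1) ≤ 4d`, the origin of the constant 4.
  2 ^ (2 ^ (suc d ℕ.+ suc d))         ≤⟨ ℕ.^-monoʳ-≤ 2 (ℕ.^-monoʳ-≤ 2 (ℕ.+-mono-≤ sd≤2d sd≤2d)) ⟩
  2 ^ (2 ^ ((d ℕ.+ d) ℕ.+ (d ℕ.+ d))) ≡⟨ cong (λ e → 2 ^ (2 ^ e)) (lem d) ⟩
  2 ^ (2 ^ (4 * d))                   ∎
  where
  open ℕ.≤-Reasoning
  sd≤2d : suc d ≤ d ℕ.+ d
  sd≤2d = ℕ.+-monoˡ-≤ d 1≤d
  lem : ∀ d → (d ℕ.+ d) ℕ.+ (d ℕ.+ d) ≡ 4 * d
  lem = ℕ-solve-∀
  n<2^n : ∀ n → n < 2 ^ n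
  n<2^n zero    = s≤s z≤n
  n<2^n (suc n) = subst (suc (suc n) ≤_) (cong (2 ^ n ℕ.+_) (sym (ℕ.+-identityʳ (2 ^ n))))
    (ℕ.+-mono-≤ (ℕ.m^n>0 2 n) (n<2^n n))

theorem3 : Σ ℕ λ C → 0 < C ×
    ((d : ℕ) → 1 ≤ d → (B : Fin (suc d) → Point d) → (b : Point d) →
    InIntCone B b →
    Σ (List (Point d × ℕ)) λ L →
    Unique (map proj₁ L) ×
    All (λ e → InConv B (proj₁ e)) L ×
    combo L ≡ b ×
    All (λ e → ¬ InB B (proj₁ e) → proj₂ e ≤ 2 ^ (2 ^ (C * d))) L ×
    length (suppOutsideB B L) ≤ 2 ^ d)
theorem3 = 4 , s≤s z≤n , λ d 1≤d B b (L , convs , L≡b) →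
  let open Reduction B
      M , (uniq , convs-M , small , few) , L≡M =
        reduce (mass outside L) (mass normSq L) L (All.map InConv⇒InConvℕ convs) ℕ.≤-refl ℕ.≤-refl
      combo≡ : ∀ j → lookup (combo M) j ≡ lookup (combo L) j
      combo≡ j = trans (lookup-combo M j) (trans (sym (L≡M j)) (sym (lookup-combo L j)))
  in M , uniq , All.map InConvℕ⇒InConv convs-M ,
     trans (lookup-ext combo≡) L≡b ,
     All.map (λ h ∉B → ℕ.≤-trans (h ∉B) (scaleBound≤ d 1≤d)) small , few
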